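{- Let $G\in\{C_8(1,2,4),\,C_8(1,3,4),\,C_8(1,2,3)\}$. For every $k\ge 3$, $\chi_{la}(G\vee O_k)=5$.
   Context: The circulant graph $C_n(1,a_1,\dots,a_t)$ has vertex set $\mathbb{Z}_n$, with $i,j$ adjacent iff their cyclic distance $\min(|i-j|,n-|i-j|)$ lies in $\{1,a_1,\dots,a_t\}$. $O_k$ is the edgeless graph on $k$ vertices, and the join $G\vee H$ of vertex-disjoint graphs has vertex set $V(G)\cup V(H)$ and edge set $E(G)\cup E(H)\cup\{uv:u\in V(G),v\in V(H)\}$. For a simple graph with $q$ edges, a bijection $f:E\to\{1,\dots,q\}$ is a local antimagic labeling if $f^+(u)\neq f^+(v)$ for every edge $uv$, where $f^+(u)=\sum_{e\ni u} f(e)$; $\chi_{la}$ is the minimum number of distinct values of $f^+$ over all local antimagic labelings. -}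

module Defs where

open import Data.Bool using (Bool; true; false; T; _∧_; _∨_; if_then_else_)
open import Data.Nat using (ℕ; zero; suc; _+_; _≤_; _<ᵇ_; _≡ᵇ_; ∣_-_∣; _⊓_; _∸_)
import Data.Nat as ℕ
open import Data.Fin using (Fin; toℕ; splitAt)
import Data.Fin as Fin
open import Data.Fin.Properties using () renaming (_≟_ to _≟ᶠ_)
open import Data.Sum using (_⊎_; inj₁; inj₂)
open import Data.Product using (_×_; _,_; proj₁; proj₂; Σ; ∃)
open import Data.Bool.ListAction using (any)
open import Data.Nat.ListAction using (sum)
open import Data.List using (List; []; _∷_; [_]; length; map; concatMap; deduplicate; lookup; allFin)
open import Function.Definitions using (Bijective)
open import Relation.Binary.PropositionalEquality using (_≡_; _≢_)
open import Relation.Nullary.Decidable using (⌊_⌋)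

-- A finite simple graph on vertex set Fin n, given by a (symmetric,
-- irreflexive) Boolean adjacency relation.
record Graph : Set where
  field
    n   : ℕ
    adj : Fin n → Fin n → Bool
open Graph public

cdist : (n : ℕ) → ℕ → ℕ → ℕ
cdist n i j = ∣ i - j ∣ ⊓ (n ∸ ∣ i - j ∣)

circulant : (n : ℕ) → List ℕ → Graph
circulant n S = record
  { n = n
  ; adj = λ i j → any (λ s → cdist n (toℕ i) (toℕ j) ≡ᵇ s) S }

joinO : Graph → ℕ → Graph
joinO G k = record
  { n = n G + k
  ; adj = λ u v → adjJ (splitAt (n G) u) (splitAt (n G) v) }
  where
  adjJ : Fin (n G) ⊎ Fin k → Fin (n G) ⊎ Fin k → Bool
  adjJ (inj₁ a) (inj₁ b) = adj G a b
  adjJ (inj₁ _) (inj₂ _) = true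
  adjJ (inj₂ _) (inj₁ _) = true
  adjJ (inj₂ _) (inj₂ _) = false

edges : (G : Graph) → List (Fin (n G) × Fin (n G))
edges G = concatMap (λ i → concatMap (λ j →
            if (toℕ i <ᵇ toℕ j) ∧ adj G i j then [ (i , j) ] else [])
          (allFin (n G))) (allFin (n G))

size : Graph → ℕ
size G = length (edges G)

-- An edge labeling: a bijection from the edge set E (indexed by Fin q)
-- onto {1,…,q}; edge e gets label 1 + π e.
record Labeling (G : Graph) : Set where
  field
    π   : Fin (size G) → Fin (size G)
    bij : Bijective _≡_ _≡_ π
open Labeling public

label : {G : Graph} → Labeling G → Fin (size G) → ℕ
label f e = suc (toℕ (π f e))

vsum : {G : Graph} → Labeling G → Fin (n G) → ℕ
vsum {G} f u = sum (map (λ e → let uv = lookup (edges G) e in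
                      if ⌊ u ≟ᶠ proj₁ uv ⌋ ∨ ⌊ u ≟ᶠ proj₂ uv ⌋ then label f e else 0)
                    (allFin (size G)))

IsLocalAntimagic : {G : Graph} → Labeling G → Set
IsLocalAntimagic {G} f = ∀ u v → T (adj G u v) → vsum f u ≢ vsum f v

numColors : {G : Graph} → Labeling G → ℕ
numColors {G} f = length (deduplicate ℕ._≟_ (map (vsum f) (allFin (n G))))

ChiLa : Graph → ℕ → Set
ChiLa G c = (Σ (Labeling G) λ f → IsLocalAntimagic f × numColors f ≡ c)
          × (∀ (f : Labeling G) → IsLocalAntimagic f → c ≤ numColors f)

{-# OPTIONS --safe #-}
-- Each G contains a K₄, so G ∨ O_k contains a K₅ and at least five colours occur.
-- For five colours, put the labels 1, …, q on G and q + M on the join edges, where M is an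
-- 8 × k matrix with entries 1, …, 8k and constant column sum 4(8k + 1).  Such an M is grown two
-- columns at a time: shift the old entries by 8 and add two columns made of the 8 smallest and
-- 8 largest labels, paired off in each row to the sum 8k + 17 (for the old k) with signs
-- + − − + + − − +, so that both new columns balance.  Every row sum grows by the same amount,
-- hence equalities and inequalities between the vertices of G persist, and it suffices to start
-- from a labeling of G ∨ O₀ and one of G ∨ O₁ whose eight G-sums take four values.
-- Row sums are quadratic and column sums linear in k, so only k < 8 can make them collide.
module Submission where

open import Defs
open import Data.Bool using (true; false; T; _∧_; _∨_; if_then_else_)
open import Data.Bool.Properties using (∧-zeroʳ)
open import Data.Nat using (ℕ; zero; suc; _+_; _*_; _≤_; _<_; _<ᵇ_; z≤n; s≤s; s<s⁻¹; _≟_; _≤?_)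
open import Data.Nat.Tactic.RingSolver using (solve-∀)
open import Data.Nat.Properties using (+-identityʳ; +-suc; +-comm; +-assoc; +-cancelʳ-≡; +-mono-≤; *-monoˡ-≤; *-monoʳ-≤; m≤m+n; m≤n+m; ≤-trans; ≤-antisym; ≤-decTotalOrder; module ≤-Reasoning; +-commutativeSemigroup; <⇒≢; suc-injective)
open import Data.Nat.ListAction using (sum)
open import Data.Nat.ListAction.Properties using (sum-++; sum-↭)
open import Data.Fin using (Fin; zero; suc; toℕ; fromℕ<; _↑ˡ_; _↑ʳ_; splitAt; join)
open import Data.Fin.Patterns using (0F; 1F; 2F; 3F; 4F; 5F; 6F; 7F)
open import Data.Fin.Properties using (toℕ-↑ˡ; toℕ-↑ʳ; ↑ˡ-injective; ↑ʳ-injective; splitAt-↑ˡ; splitAt-↑ʳ; join-splitAt; all?; toℕ<n; toℕ-fromℕ<; toℕ-injective; injective⇒≤) renaming (_≟_ to _≟ᶠ_)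
open import Data.List using (List; []; _∷_; [_]; length; map; concat; concatMap; lookup; tabulate; allFin; applyUpTo; _++_; deduplicate)
open import Data.List.Properties using (map-id; map-cong; map-tabulate; map-applyUpTo; map-concatMap; map-++; map-∘; length-map; length-applyUpTo; concat-map; ≡-dec; ++-assoc; ++-identityʳ; concatMap-cong; concatMap-map; concatMap-pure; concatMap-++; tabulate-cong; tabulate-lookup)
open import Data.List.Membership.Propositional using (_∈_)
open import Data.List.Membership.Propositional.Properties using (∈-map⁺; ∈-map⁻; ∈-lookup; ∈-allFin; ∈-applyUpTo⁺; ∈-applyUpTo⁻; ∈-deduplicate⁺; ∈-deduplicate⁻; ∈-tabulate⁺)
open import Data.List.Relation.Unary.All as All using (All; []; _∷_)
import Data.List.Relation.Unary.All.Properties as All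
open import Data.List.Relation.Unary.Any using (index; here; there)
open import Data.List.Relation.Unary.Any.Properties using (lookup-index)
open import Data.List.Relation.Unary.AllPairs as AllPairs using (AllPairs; []; _∷_; allPairs?)
import Data.List.Relation.Unary.AllPairs.Properties as AllPairs
open import Data.List.Relation.Unary.Unique.Propositional using (Unique)
open import Data.List.Relation.Unary.Unique.Propositional.Properties using (applyUpTo⁺₁)
open import Data.List.Relation.Unary.Unique.DecPropositional.Properties _≟_ using (deduplicate-!)
open import Data.List.Relation.Binary.Subset.Propositional using (_⊆_)
open import Data.List.Relation.Binary.Permutation.Propositional using (_↭_; ↭-refl; ↭-reflexive; ↭-sym; ↭⇒↭ₛ; module PermutationReasoning)
open import Data.List.Relation.Binary.Permutation.Propositional.Properties using (map⁺; ++⁺; ++⁺ˡ; ++-comm; shifts; ∈-resp-↭; ↭-length)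
import Data.List.Relation.Binary.Permutation.Setoid.Properties as ↭ₛ
open import Data.Product using (Σ; ∃; _×_; _,_; proj₁; proj₂)
open import Data.Vec as Vec using (Vec; []; _∷_)
open import Data.Empty using (⊥)
open import Data.List.Sort.InsertionSort.Base ≤-decTotalOrder using (sort)
open import Data.List.Sort.InsertionSort.Properties ≤-decTotalOrder using (sort-↭)
open import Data.Sum using (_⊎_; inj₁; inj₂)
open import Function using (_∘_; id; mk⇔)
open import Relation.Binary.PropositionalEquality using (_≡_; _≢_; _≗_; refl; sym; trans; cong; cong₂; subst; setoid; module ≡-Reasoning)
open import Relation.Nullary using (contradiction; Dec; ¬?)
open import Relation.Nullary.Decidable using (⌊_⌋; _×-dec_; _→-dec_; T?; True; toWitness; does-⇔; dec-false; dec-true; isYes≗does)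

-- Lists: pigeonhole counting and order of enumeration.

private variable
  A B C : Set

-- The function `f` covers two uses: `f = id` for counting below, and edge weights when a labeling
-- is shown to be injective.
Unique⇒lookup-injective : ∀ (f : A → B) xs → Unique (map f xs) →
                          ∀ i j → f (lookup xs i) ≡ f (lookup xs j) → i ≡ j
Unique⇒lookup-injective f (x ∷ xs) (x∉ ∷ u) zero    zero    eq = refl
Unique⇒lookup-injective f (x ∷ xs) (x∉ ∷ u) zero    (suc j) eq =
  contradiction eq (All.lookup x∉ (∈-map⁺ f (∈-lookup j)))
Unique⇒lookup-injective f (x ∷ xs) (x∉ ∷ u) (suc i) zero    eq =
  contradiction (sym eq) (All.lookup x∉ (∈-map⁺ f (∈-lookup i)))
Unique⇒lookup-injective f (x ∷ xs) (x∉ ∷ u) (suc i) (suc j) eq =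
  cong suc (Unique⇒lookup-injective f xs u i j eq)

-- Pigeonhole: sending each index of `xs` to the position of its entry in `ys` is injective. Both
-- bounds on the number of colours rest on this.
Unique-⊆⇒length-≤ : ∀ {xs ys : List A} → Unique xs → xs ⊆ ys → length xs ≤ length ys
Unique-⊆⇒length-≤ {xs = xs} {ys} u xs⊆ys = injective⇒≤ {f = position} position-injective
  where
  position : Fin (length xs) → Fin (length ys)
  position i = index (xs⊆ys (∈-lookup i))

  lookup-position : ∀ i → lookup xs i ≡ lookup ys (position i)
  lookup-position i = lookup-index (xs⊆ys (∈-lookup i))

  position-injective : ∀ {i j} → position i ≡ position j → i ≡ j
  position-injective {i} {j} eq = Unique⇒lookup-injective id xs (subst Unique (sym (map-id xs)) u) i j
    (trans (lookup-position i) (trans (cong (lookup ys) eq) (sym (lookup-position j))))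

concatMap-++-↭ : ∀ (f g : A → List B) xs →
                 concatMap (λ x → f x ++ g x) xs ↭ concatMap f xs ++ concatMap g xs
concatMap-++-↭ f g []       = ↭-refl
concatMap-++-↭ f g (x ∷ xs) = begin
  (f x ++ g x) ++ concatMap (λ x → f x ++ g x) xs    ↭⟨ ++⁺ˡ (f x ++ g x) (concatMap-++-↭ f g xs) ⟩
  (f x ++ g x) ++ concatMap f xs ++ concatMap g xs   ≡⟨ ++-assoc (f x) (g x) _ ⟩
  f x ++ g x ++ concatMap f xs ++ concatMap g xs     ↭⟨ ++⁺ˡ (f x) (shifts (g x) (concatMap f xs)) ⟩
  f x ++ concatMap f xs ++ g x ++ concatMap g xs     ≡⟨ ++-assoc (f x) _ _ ⟨
  (f x ++ concatMap f xs) ++ g x ++ concatMap g xs   ∎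
  where open PermutationReasoning

concatMap-[] : ∀ (xs : List A) → concatMap {B = B} (λ _ → []) xs ≡ []
concatMap-[] []       = refl
concatMap-[] (x ∷ xs) = concatMap-[] xs

-- Needed because `edges` lists the join edges grouped by the vertex of G, whereas the matrix is
-- read column by column. The induction peels off one column at a time.
concatMap-transpose : ∀ (f : A → B → C) xs ys →
  concatMap (λ x → map (f x) ys) xs ↭ concatMap (λ y → map (λ x → f x y) xs) ys
concatMap-transpose f xs []       = ↭-reflexive (concatMap-[] xs)
concatMap-transpose f xs (y ∷ ys) = begin
  concatMap (λ x → [ f x y ] ++ map (f x) ys) xs                        ↭⟨ concatMap-++-↭ (λ x → [ f x y ]) _ xs ⟩
  concatMap (λ x → [ f x y ]) xs ++ concatMap (λ x → map (f x) ys) xs   ≡⟨ cong (_++ _) (concatMap-map [_] (λ x → f x y) xs) ⟨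
  concatMap [_] (map (λ x → f x y) xs) ++ _                             ≡⟨ cong (_++ _) (concatMap-pure (map (λ x → f x y) xs)) ⟩
  map (λ x → f x y) xs ++ concatMap (λ x → map (f x) ys) xs             ↭⟨ ++⁺ˡ (map (λ x → f x y) xs) (concatMap-transpose f xs ys) ⟩
  map (λ x → f x y) xs ++ concatMap (λ y → map (λ x → f x y) xs) ys     ∎
  where open PermutationReasoning

tabulate-+ : ∀ m {n} (f : Fin (m + n) → A) →
             tabulate f ≡ tabulate (λ i → f (i ↑ˡ n)) ++ tabulate (λ i → f (m ↑ʳ i))
tabulate-+ zero    f = refl
tabulate-+ (suc m) f = cong (f zero ∷_) (tabulate-+ m (f ∘ suc))

concatMap-allFin-+ : ∀ m {k} (f : Fin (m + k) → List A) →
  concatMap f (allFin (m + k)) ≡ concatMap (λ i → f (i ↑ˡ k)) (allFin m) ++ concatMap (λ i → f (m ↑ʳ i)) (allFin k)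
concatMap-allFin-+ m {k} f = begin
  concatMap f (allFin (m + k))
    ≡⟨ cong (concatMap f) (tabulate-+ m id) ⟩
  concatMap f (tabulate (_↑ˡ k) ++ tabulate (m ↑ʳ_))
    ≡⟨ cong₂ (λ xs ys → concatMap f (xs ++ ys)) (sym (map-tabulate id (_↑ˡ k))) (sym (map-tabulate id (m ↑ʳ_))) ⟩
  concatMap f (map (_↑ˡ k) (allFin m) ++ map (m ↑ʳ_) (allFin k))
    ≡⟨ concatMap-++ f (map (_↑ˡ k) (allFin m)) _ ⟩
  concatMap f (map (_↑ˡ k) (allFin m)) ++ concatMap f (map (m ↑ʳ_) (allFin k))
    ≡⟨ cong₂ _++_ (concatMap-map f (_↑ˡ k) (allFin m)) (concatMap-map f (m ↑ʳ_) (allFin k)) ⟩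
  concatMap (λ i → f (i ↑ˡ k)) (allFin m) ++ concatMap (λ i → f (m ↑ʳ i)) (allFin k) ∎
  where open ≡-Reasoning

-- Finite sums, and matrices read by columns.

∑ : ∀ {n} → (Fin n → ℕ) → ℕ
∑ f = sum (tabulate f)

∑-cong : ∀ {n} {f g : Fin n → ℕ} → f ≗ g → ∑ f ≡ ∑ g
∑-cong f≗g = cong sum (tabulate-cong f≗g)

∑-zero : ∀ {n} {f : Fin n → ℕ} → (∀ i → f i ≡ 0) → ∑ f ≡ 0
∑-zero {zero}  f≗0 = refl
∑-zero {suc n} f≗0 = cong₂ _+_ (f≗0 zero) (∑-zero (f≗0 ∘ suc))

∑-const-+ : ∀ {n} a (f : Fin n → ℕ) → ∑ (λ i → a + f i) ≡ n * a + ∑ f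
∑-const-+ {zero}  a f = refl
∑-const-+ {suc n} a f = begin
  a + f zero + ∑ (λ i → a + f (suc i))  ≡⟨ cong (a + f zero +_) (∑-const-+ a (f ∘ suc)) ⟩
  a + f zero + (n * a + ∑ (f ∘ suc))    ≡⟨ interchange a (f zero) (n * a) _ ⟩
  a + n * a + (f zero + ∑ (f ∘ suc))    ∎
  where
  open ≡-Reasoning
  open import Algebra.Properties.CommutativeSemigroup +-commutativeSemigroup using (interchange)

∑-single : ∀ {n} (j : Fin n) (f : Fin n → ℕ) → (∀ i → j ≢ i → f i ≡ 0) → ∑ f ≡ f j
∑-single zero    f f≗0 = trans (cong (f zero +_) (∑-zero (λ i → f≗0 (suc i) λ ()))) (+-identityʳ _)
∑-single (suc j) f f≗0 = trans (cong (_+ ∑ (f ∘ suc)) (f≗0 zero λ ()))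
  (∑-single j (f ∘ suc) (λ i j≢i → f≗0 (suc i) (λ { refl → j≢i refl })))

-- Reading by columns makes new leading columns appear as a prefix of the list.
columns : ∀ {m k} → (Fin m → Fin k → A) → List A
columns M = concat (tabulate (λ c → tabulate (λ a → M a c)))

columns-cong : ∀ {m k} {M N : Fin m → Fin k → A} → (∀ a c → M a c ≡ N a c) → columns M ≡ columns N
columns-cong M≗N = cong concat (tabulate-cong (λ c → tabulate-cong (λ a → M≗N a c)))

columns-map : ∀ {m k} (f : A → B) (M : Fin m → Fin k → A) → columns (λ a c → f (M a c)) ≡ map f (columns M)
columns-map f M = begin
  concat (tabulate (λ c → tabulate (λ a → f (M a c))))          ≡⟨ cong concat (tabulate-cong (λ c → map-tabulate (λ a → M a c) f)) ⟨
  concat (tabulate (λ c → map f (tabulate (λ a → M a c))))      ≡⟨ cong concat (map-tabulate (λ c → tabulate (λ a → M a c)) (map f)) ⟨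
  concat (map (map f) (tabulate (λ c → tabulate (λ a → M a c)))) ≡⟨ concat-map (tabulate (λ c → tabulate (λ a → M a c))) ⟩
  map f (columns M)                                             ∎
  where open ≡-Reasoning

sum-columns : ∀ {m k} (M : Fin m → Fin k → ℕ) → sum (columns M) ≡ ∑ (λ c → ∑ (λ a → M a c))
sum-columns {k = zero}  M = refl
sum-columns {k = suc k} M = trans (sum-++ (tabulate (λ a → M a zero)) _) (cong (∑ (λ a → M a zero) +_) (sum-columns (λ a c → M a (suc c))))

sum-map-zero : ∀ {f : A → ℕ} → (∀ x → f x ≡ 0) → ∀ xs → sum (map f xs) ≡ 0
sum-map-zero f≗0 []       = refl
sum-map-zero f≗0 (x ∷ xs) = cong₂ _+_ (f≗0 x) (sum-map-zero f≗0 xs)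

-- The label list 1, ..., q.

labels : ℕ → List ℕ
labels = applyUpTo suc

labels-+ : ∀ m n → labels (m + n) ≡ labels m ++ map (m +_) (labels n)
labels-+ m n = trans (applyUpTo-+ suc m) (cong (labels m ++_) (trans (applyUpTo-cong (λ i → sym (+-suc m i)) n) (sym (map-applyUpTo suc (m +_) n))))
  where
  applyUpTo-+ : ∀ (f : ℕ → ℕ) m → applyUpTo f (m + n) ≡ applyUpTo f m ++ applyUpTo (λ i → f (m + i)) n
  applyUpTo-+ f zero    = refl
  applyUpTo-+ f (suc m) = cong (f zero ∷_) (applyUpTo-+ (f ∘ suc) m)

  applyUpTo-cong : ∀ {f g : ℕ → ℕ} → f ≗ g → ∀ n → applyUpTo f n ≡ applyUpTo g n
  applyUpTo-cong f≗g zero    = refl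
  applyUpTo-cong f≗g (suc n) = cong₂ _∷_ (f≗g zero) (applyUpTo-cong (f≗g ∘ suc) n)

labels-unique : ∀ n → Unique (labels n)
labels-unique n = applyUpTo⁺₁ suc n (λ i<j _ eq → <⇒≢ i<j (suc-injective eq))

-- Permutations preserve length, so `q` is forced. This yields the number of edges of the join
-- without a separate count.
labels-length : ∀ {f : A → ℕ} xs {q} → map f xs ↭ labels q → map f xs ↭ labels (length xs)
labels-length {f = f} xs {q} p = subst (λ l → map f xs ↭ labels l) q≡length p
  where
  q≡length : q ≡ length xs
  q≡length = trans (sym (length-applyUpTo suc q)) (trans (sym (↭-length p)) (length-map f xs))

-- Labelings given by weights on edges.

Edge : Graph → Set
Edge G = Fin (n G) × Fin (n G)

-- This is `vsum` with edges in place of edge indices, so that the edge list may be permuted.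
incidenceSum : (G : Graph) → (Edge G → ℕ) → Fin (n G) → ℕ
incidenceSum G w u = sum (map (λ e → if ⌊ u ≟ᶠ proj₁ e ⌋ ∨ ⌊ u ≟ᶠ proj₂ e ⌋ then w e else 0) (edges G))

module FromWeights (G : Graph) (w : Edge G → ℕ) (w-perm : map w (edges G) ↭ labels (size G)) where

  private
    weight : Fin (size G) → ℕ
    weight e = w (lookup (edges G) e)

    weight∈labels : ∀ e → ∃ λ i → i < size G × weight e ≡ suc i
    weight∈labels e = ∈-applyUpTo⁻ suc (∈-resp-↭ w-perm (∈-map⁺ w (∈-lookup e)))

    -- The position is the weight minus one, since `label` adds one to `π`.
    position : Fin (size G) → Fin (size G)
    position e = fromℕ< (proj₁ (proj₂ (weight∈labels e)))

    suc-position : ∀ e → suc (toℕ (position e)) ≡ weight e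
    suc-position e = trans (cong suc (toℕ-fromℕ< _)) (sym (proj₂ (proj₂ (weight∈labels e))))

    weights-unique : Unique (map w (edges G))
    weights-unique = ↭ₛ.Unique-resp-↭ (setoid ℕ) (↭⇒↭ₛ (↭-sym w-perm)) (labels-unique _)

    position-injective : ∀ {d e} → position d ≡ position e → d ≡ e
    position-injective {d} {e} eq = Unique⇒lookup-injective w (edges G) weights-unique d e
      (trans (sym (suc-position d)) (trans (cong (suc ∘ toℕ) eq) (suc-position e)))

    position-surjective : ∀ y → ∃ λ e → position e ≡ y
    position-surjective y with ∈-map⁻ w (∈-resp-↭ (↭-sym w-perm) (∈-applyUpTo⁺ suc (toℕ<n y)))
    ... | x , x∈ , eq = index x∈ , toℕ-injective (suc-injective
      (trans (suc-position (index x∈)) (trans (cong w (sym (lookup-index x∈))) (sym eq))))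

  labeling : Labeling G
  labeling = record
    { π   = position
    ; bij = position-injective , λ y → proj₁ (position-surjective y) , λ { refl → proj₂ (position-surjective y) } }

  vsum-labeling : ∀ u → vsum labeling u ≡ incidenceSum G w u
  vsum-labeling u = cong sum (begin
    map (λ e → inc (lookup (edges G) e) (label labeling e)) (allFin (size G))  ≡⟨ map-cong (λ e → cong (inc (lookup (edges G) e)) (suc-position e)) (allFin (size G)) ⟩
    map (λ e → inc (lookup (edges G) e) (weight e)) (allFin (size G))           ≡⟨ map-tabulate id _ ⟩
    tabulate (λ e → inc (lookup (edges G) e) (weight e))                        ≡⟨ map-tabulate (lookup (edges G)) (λ e → inc e (w e)) ⟨
    map (λ e → inc e (w e)) (tabulate (lookup (edges G)))                       ≡⟨ cong (map (λ e → inc e (w e))) (tabulate-lookup (edges G)) ⟩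
    map (λ e → inc e (w e)) (edges G)                                           ∎)
    where
    open ≡-Reasoning
    inc : Edge G → ℕ → ℕ
    inc e x = if ⌊ u ≟ᶠ proj₁ e ⌋ ∨ ⌊ u ≟ᶠ proj₂ e ⌋ then x else 0

-- Bounds on the number of colours.

numColors-≤ : ∀ {G} (f : Labeling G) (cs : List ℕ) → (∀ u → vsum f u ∈ cs) → numColors f ≤ length cs
numColors-≤ {G} f cs vsum∈cs = Unique-⊆⇒length-≤ (deduplicate-! (map (vsum f) (allFin (n G)))) λ z∈ →
  let u , _ , z≡ = ∈-map⁻ (vsum f) (∈-deduplicate⁻ _≟_ (map (vsum f) (allFin (n G))) z∈)
  in subst (_∈ cs) (sym z≡) (vsum∈cs u)

Clique : (G : Graph) → List (Fin (n G)) → Set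
Clique G = AllPairs (λ u v → T (adj G u v))

-- Pairwise adjacent vertices have pairwise different sums, so these sums form a duplicate-free list
-- of colours.
clique-bound : ∀ {G us} → Clique G us → (f : Labeling G) → IsLocalAntimagic f → length us ≤ numColors f
clique-bound {G} {us} clique f antimagic = subst (_≤ numColors f) (length-map (vsum f) us)
  (Unique-⊆⇒length-≤ (AllPairs.map⁺ (AllPairs.map (antimagic _ _) clique)) λ z∈ →
    let u , _ , z≡ = ∈-map⁻ (vsum f) z∈
    in ∈-deduplicate⁺ _≟_ (subst (_∈ map (vsum f) (allFin (n G))) (sym z≡) (∈-map⁺ (vsum f) (∈-allFin u))))

-- The join with an edgeless graph: adjacency, cliques and edges.

module _ (G : Graph) (k : ℕ) where

  private
    m = n G
    H = joinO G k

  adj-ˡˡ : ∀ a b → adj H (a ↑ˡ k) (b ↑ˡ k) ≡ adj G a b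
  adj-ˡˡ a b rewrite splitAt-↑ˡ m a k | splitAt-↑ˡ m b k = refl

  adj-ˡʳ : ∀ a c → adj H (a ↑ˡ k) (m ↑ʳ c) ≡ true
  adj-ˡʳ a c rewrite splitAt-↑ˡ m a k | splitAt-↑ʳ m k c = refl

  adj-ʳˡ : ∀ c a → adj H (m ↑ʳ c) (a ↑ˡ k) ≡ true
  adj-ʳˡ c a rewrite splitAt-↑ˡ m a k | splitAt-↑ʳ m k c = refl

  adj-ʳʳ : ∀ c d → adj H (m ↑ʳ c) (m ↑ʳ d) ≡ false
  adj-ʳʳ c d rewrite splitAt-↑ʳ m k c | splitAt-↑ʳ m k d = refl

  -- A vertex of O_k sees all of G; this turns a K₄ into a K₅.
  clique-joinO : ∀ c {us} → Clique G us → Clique H ((m ↑ʳ c) ∷ map (_↑ˡ k) us)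
  clique-joinO c clique =
    All.map⁺ (All.universal (λ a → subst T (sym (adj-ʳˡ c a)) _) _)
    ∷ AllPairs.map⁺ (AllPairs.map (λ {a} {b} → subst T (sym (adj-ˡˡ a b))) clique)

  embedEdge : Edge G → Edge H
  embedEdge (a , b) = a ↑ˡ k , b ↑ˡ k

  joinEdge : Fin m → Fin k → Edge H
  joinEdge a c = a ↑ˡ k , m ↑ʳ c

  joinEdges : List (Edge H)
  joinEdges = concatMap (λ c → map (λ a → joinEdge a c) (allFin m)) (allFin k)

  -- The vertices of G are numbered before those of O_k, so every join edge is listed at its end in
  -- G, and the rows of O_k contribute nothing. It remains to separate the old edges from the join
  -- edges and to transpose the latter.
  edges-joinO : edges H ↭ map embedEdge (edges G) ++ joinEdges
  edges-joinO = begin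
    edges H
      ≡⟨ concatMap-allFin-+ m (λ u → concatMap (cell u) (allFin (m + k))) ⟩
    concatMap (λ a → concatMap (cell (a ↑ˡ k)) (allFin (m + k))) (allFin m) ++ concatMap (λ c → concatMap (cell (m ↑ʳ c)) (allFin (m + k))) (allFin k)
      ≡⟨ cong₂ _++_ (concatMap-cong upper (allFin m)) (trans (concatMap-cong lower (allFin k)) (concatMap-[] (allFin k))) ⟩
    concatMap (λ a → map embedEdge (row a) ++ map (joinEdge a) (allFin k)) (allFin m) ++ []
      ≡⟨ ++-identityʳ _ ⟩
    concatMap (λ a → map embedEdge (row a) ++ map (joinEdge a) (allFin k)) (allFin m)
      ↭⟨ concatMap-++-↭ (map embedEdge ∘ row) _ (allFin m) ⟩
    concatMap (map embedEdge ∘ row) (allFin m) ++ concatMap (λ a → map (joinEdge a) (allFin k)) (allFin m)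
      ↭⟨ ++⁺ (↭-reflexive (sym (map-concatMap embedEdge row (allFin m)))) (concatMap-transpose joinEdge (allFin m) (allFin k)) ⟩
    map embedEdge (edges G) ++ joinEdges ∎
    where
    open PermutationReasoning

    cell : Fin (m + k) → Fin (m + k) → List (Edge H)
    cell u v = if (toℕ u <ᵇ toℕ v) ∧ adj H u v then [ (u , v) ] else []

    row : Fin m → List (Edge G)
    row a = concatMap (λ b → if (toℕ a <ᵇ toℕ b) ∧ adj G a b then [ (a , b) ] else []) (allFin m)

    <ᵇ-+ : ∀ {p q} r → p < q → (p <ᵇ q + r) ≡ true
    <ᵇ-+ {zero}  {suc q} r _   = refl
    <ᵇ-+ {suc p} {suc q} r p<q = <ᵇ-+ r (s<s⁻¹ p<q)

    ≮ᵇ-+ : ∀ {p q} r → p < q → (q + r <ᵇ p) ≡ false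
    ≮ᵇ-+ {zero}  {suc q} r _   = refl
    ≮ᵇ-+ {suc p} {suc q} r p<q = ≮ᵇ-+ r (s<s⁻¹ p<q)

    cell-ˡˡ : ∀ a b → cell (a ↑ˡ k) (b ↑ˡ k) ≡ map embedEdge (if (toℕ a <ᵇ toℕ b) ∧ adj G a b then [ (a , b) ] else [])
    cell-ˡˡ a b rewrite adj-ˡˡ a b | toℕ-↑ˡ a k | toℕ-↑ˡ b k with (toℕ a <ᵇ toℕ b) ∧ adj G a b
    ... | true  = refl
    ... | false = refl

    cell-ˡʳ : ∀ a c → cell (a ↑ˡ k) (m ↑ʳ c) ≡ [ joinEdge a c ]
    cell-ˡʳ a c rewrite adj-ˡʳ a c | toℕ-↑ˡ a k | toℕ-↑ʳ m c | <ᵇ-+ (toℕ c) (toℕ<n a) = refl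

    cell-ʳˡ : ∀ c a → cell (m ↑ʳ c) (a ↑ˡ k) ≡ []
    cell-ʳˡ c a rewrite toℕ-↑ˡ a k | toℕ-↑ʳ m c | ≮ᵇ-+ (toℕ c) (toℕ<n a) = refl

    cell-ʳʳ : ∀ c d → cell (m ↑ʳ c) (m ↑ʳ d) ≡ []
    cell-ʳʳ c d rewrite adj-ʳʳ c d | ∧-zeroʳ (toℕ (m ↑ʳ c) <ᵇ toℕ (m ↑ʳ d)) = refl

    upper : ∀ a → concatMap (cell (a ↑ˡ k)) (allFin (m + k)) ≡ map embedEdge (row a) ++ map (joinEdge a) (allFin k)
    upper a = trans (concatMap-allFin-+ m (cell (a ↑ˡ k))) (cong₂ _++_
      (trans (concatMap-cong (cell-ˡˡ a) (allFin m)) (sym (map-concatMap embedEdge _ (allFin m))))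
      (trans (concatMap-cong (cell-ˡʳ a) (allFin k))
        (trans (sym (concatMap-map [_] (joinEdge a) (allFin k))) (concatMap-pure (map (joinEdge a) (allFin k))))))

    lower : ∀ c → concatMap (cell (m ↑ʳ c)) (allFin (m + k)) ≡ []
    lower c = trans (concatMap-allFin-+ m (cell (m ↑ʳ c))) (cong₂ _++_
      (trans (concatMap-cong (cell-ʳˡ c) (allFin m)) (concatMap-[] (allFin m)))
      (trans (concatMap-cong (cell-ʳʳ c) (allFin k)) (concatMap-[] (allFin k))))

  private
    ↑ˡ≢↑ʳ : ∀ a c → a ↑ˡ k ≢ m ↑ʳ c
    ↑ˡ≢↑ʳ a c eq with () ← trans (sym (splitAt-↑ˡ m a k)) (trans (cong (splitAt m) eq) (splitAt-↑ʳ m k c))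

    ≟-≢ : ∀ {l} {u v : Fin l} → u ≢ v → ⌊ u ≟ᶠ v ⌋ ≡ false
    ≟-≢ {u = u} {v} u≢v = trans (isYes≗does (u ≟ᶠ v)) (dec-false (u ≟ᶠ v) u≢v)

    ≟-refl : ∀ {l} (u : Fin l) → ⌊ u ≟ᶠ u ⌋ ≡ true
    ≟-refl u = trans (isYes≗does (u ≟ᶠ u)) (dec-true (u ≟ᶠ u) refl)

    ≟-↑ˡ : ∀ (a b : Fin m) → ⌊ (a ↑ˡ k) ≟ᶠ (b ↑ˡ k) ⌋ ≡ ⌊ a ≟ᶠ b ⌋
    ≟-↑ˡ a b = trans (isYes≗does ((a ↑ˡ k) ≟ᶠ (b ↑ˡ k)))
      (trans (does-⇔ (mk⇔ (↑ˡ-injective k a b) (cong (_↑ˡ k))) ((a ↑ˡ k) ≟ᶠ (b ↑ˡ k)) (a ≟ᶠ b)) (sym (isYes≗does (a ≟ᶠ b))))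

    map-joinEdges : ∀ {X : Set} (h : Edge H → X) →
      map h joinEdges ≡ columns (λ a c → h (joinEdge a c))
    map-joinEdges h = begin
      map h joinEdges
        ≡⟨ map-concatMap h _ (allFin k) ⟩
      concatMap (λ c → map h (map (λ a → joinEdge a c) (allFin m))) (allFin k)
        ≡⟨ concatMap-cong (λ c → trans (cong (map h) (map-tabulate id (λ a → joinEdge a c))) (map-tabulate (λ a → joinEdge a c) h)) (allFin k) ⟩
      concatMap (λ c → tabulate (λ a → h (joinEdge a c))) (allFin k)
        ≡⟨ cong concat (map-tabulate id (λ c → tabulate (λ a → h (joinEdge a c)))) ⟩
      columns (λ a c → h (joinEdge a c)) ∎
      where open ≡-Reasoning

    sum-edges-joinO : ∀ (h : Edge H → ℕ) →
      sum (map h (edges H)) ≡ sum (map (h ∘ embedEdge) (edges G)) + ∑ (λ c → ∑ (λ a → h (joinEdge a c)))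
    sum-edges-joinO h = begin
      sum (map h (edges H))                                ≡⟨ sum-↭ (map⁺ h edges-joinO) ⟩
      sum (map h (map embedEdge (edges G) ++ joinEdges))   ≡⟨ cong sum (map-++ h (map embedEdge (edges G)) joinEdges) ⟩
      sum (map h (map embedEdge (edges G)) ++ map h joinEdges)
        ≡⟨ sum-++ (map h (map embedEdge (edges G))) _ ⟩
      sum (map h (map embedEdge (edges G))) + sum (map h joinEdges)
        ≡⟨ cong₂ _+_ (cong sum (sym (map-∘ (edges G)))) (trans (cong sum (map-joinEdges h)) (sum-columns (λ a c → h (joinEdge a c)))) ⟩
      sum (map (h ∘ embedEdge) (edges G)) + ∑ (λ c → ∑ (λ a → h (joinEdge a c))) ∎
      where
      open ≡-Reasoning

  -- The labeling of the join obtained from weights on G and a matrix.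

  -- Row sums are split as `g + s a` with `g` common to all rows: comparisons inside G then involve
  -- only the incidence sum plus `s`, and `g` matters only against the column sums.
  module JoinLabeling (wG : Edge G → ℕ) (wG-perm : map wG (edges G) ↭ labels (size G))
                      (M : Fin m → Fin k → ℕ) (M-perm : columns M ↭ labels (k * m))
    (s : Fin m → ℕ) (g z : ℕ) (rowSum : ∀ a → ∑ (M a) ≡ g + s a) (columnSum : ∀ c → ∑ (λ a → M a c) ≡ z)
    (proper : ∀ a b → T (adj G a b) → incidenceSum G wG a + s a ≢ incidenceSum G wG b + s b)
    (row≢column : ∀ a → incidenceSum G wG a + s a + (k * size G + g) ≢ m * size G + z) where

    private
      weightJ : Fin m ⊎ Fin k → Fin m ⊎ Fin k → ℕ
      weightJ (inj₁ a) (inj₁ b) = wG (a , b)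
      weightJ (inj₁ a) (inj₂ c) = size G + M a c
      -- A default value: no listed edge has its first end in O_k.
      weightJ (inj₂ _) _        = 0

      w : Edge H → ℕ
      w (u , v) = weightJ (splitAt m u) (splitAt m v)

      w-embed : ∀ e → w (embedEdge e) ≡ wG e
      w-embed (a , b) = cong₂ weightJ (splitAt-↑ˡ m a k) (splitAt-↑ˡ m b k)

      w-join : ∀ a c → w (joinEdge a c) ≡ size G + M a c
      w-join a c = cong₂ weightJ (splitAt-↑ˡ m a k) (splitAt-↑ʳ m k c)

      w-perm : map w (edges H) ↭ labels (size G + k * m)
      w-perm = begin
        map w (edges H)                                            ↭⟨ map⁺ w edges-joinO ⟩
        map w (map embedEdge (edges G) ++ joinEdges)               ≡⟨ map-++ w (map embedEdge (edges G)) joinEdges ⟩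
        map w (map embedEdge (edges G)) ++ map w joinEdges         ≡⟨ cong₂ _++_ (trans (sym (map-∘ (edges G))) (map-cong w-embed (edges G))) (map-joinEdges w) ⟩
        map wG (edges G) ++ columns (λ a c → w (joinEdge a c))     ≡⟨ cong (map wG (edges G) ++_) (trans (columns-cong w-join) (columns-map (size G +_) M)) ⟩
        map wG (edges G) ++ map (size G +_) (columns M)            ↭⟨ ++⁺ wG-perm (map⁺ (size G +_) M-perm) ⟩
        labels (size G) ++ map (size G +_) (labels (k * m))        ≡⟨ labels-+ (size G) (k * m) ⟨
        labels (size G + k * m)                                    ∎
        where
        open PermutationReasoning

      module F = FromWeights H w (labels-length (edges H) w-perm)

    labeling : Labeling H
    labeling = F.labeling

    vsum-↑ˡ : ∀ a → vsum labeling (a ↑ˡ k) ≡ incidenceSum G wG a + ∑ (λ c → size G + M a c)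
    vsum-↑ˡ a = trans (F.vsum-labeling (a ↑ˡ k)) (trans (sum-edges-joinO _) (cong₂ _+_
      (cong sum (map-cong old (edges G))) (∑-cong new)))
      where
      old : ∀ e → (if ⌊ (a ↑ˡ k) ≟ᶠ (proj₁ e ↑ˡ k) ⌋ ∨ ⌊ (a ↑ˡ k) ≟ᶠ (proj₂ e ↑ˡ k) ⌋ then w (embedEdge e) else 0)
                ≡ (if ⌊ a ≟ᶠ proj₁ e ⌋ ∨ ⌊ a ≟ᶠ proj₂ e ⌋ then wG e else 0)
      old e rewrite ≟-↑ˡ a (proj₁ e) | ≟-↑ˡ a (proj₂ e) | w-embed e = refl

      term : Fin k → Fin m → ℕ
      term c b = if ⌊ (a ↑ˡ k) ≟ᶠ (b ↑ˡ k) ⌋ ∨ ⌊ (a ↑ˡ k) ≟ᶠ (m ↑ʳ c) ⌋ then w (joinEdge b c) else 0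

      off : ∀ c b → a ≢ b → term c b ≡ 0
      off c b a≢b rewrite ≟-≢ (a≢b ∘ ↑ˡ-injective k a b) | ≟-≢ (↑ˡ≢↑ʳ a c) = refl

      on : ∀ c → term c a ≡ size G + M a c
      on c rewrite ≟-refl (a ↑ˡ k) = w-join a c

      -- Exactly one join edge connects `a` with the vertex `c` of O_k.
      new : ∀ c → ∑ (term c) ≡ size G + M a c
      new c = trans (∑-single a (term c) (off c)) (on c)

    vsum-↑ʳ : ∀ c → vsum labeling (m ↑ʳ c) ≡ ∑ (λ a → size G + M a c)
    vsum-↑ʳ c = trans (F.vsum-labeling (m ↑ʳ c)) (trans (sum-edges-joinO _) (cong₂ _+_
      (sum-map-zero old (edges G)) (trans (∑-single c (λ d → ∑ (term d)) (λ d c≢d → ∑-zero (off d c≢d))) (∑-cong on))))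
      where
      old : ∀ e → (if ⌊ (m ↑ʳ c) ≟ᶠ (proj₁ e ↑ˡ k) ⌋ ∨ ⌊ (m ↑ʳ c) ≟ᶠ (proj₂ e ↑ˡ k) ⌋ then w (embedEdge e) else 0) ≡ 0
      old e rewrite ≟-≢ (↑ˡ≢↑ʳ (proj₁ e) c ∘ sym) | ≟-≢ (↑ˡ≢↑ʳ (proj₂ e) c ∘ sym) = refl

      term : Fin k → Fin m → ℕ
      term d b = if ⌊ (m ↑ʳ c) ≟ᶠ (b ↑ˡ k) ⌋ ∨ ⌊ (m ↑ʳ c) ≟ᶠ (m ↑ʳ d) ⌋ then w (joinEdge b d) else 0

      off : ∀ d → c ≢ d → ∀ b → term d b ≡ 0
      off d c≢d b rewrite ≟-≢ (↑ˡ≢↑ʳ b c ∘ sym) | ≟-≢ (c≢d ∘ ↑ʳ-injective m c d) = refl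

      on : ∀ b → term c b ≡ size G + M b c
      on b rewrite ≟-≢ (↑ˡ≢↑ʳ b c ∘ sym) | ≟-refl (m ↑ʳ c) = w-join b c

    private
      base : Fin m → ℕ
      base a = incidenceSum G wG a + s a

      common : ℕ
      common = k * size G + g

      vsum-row : ∀ a → vsum labeling (a ↑ˡ k) ≡ base a + common
      vsum-row a = begin
        vsum labeling (a ↑ˡ k)                                    ≡⟨ vsum-↑ˡ a ⟩
        incidenceSum G wG a + ∑ (λ c → size G + M a c)            ≡⟨ cong (incidenceSum G wG a +_) (∑-const-+ (size G) (M a)) ⟩
        incidenceSum G wG a + (k * size G + ∑ (M a))              ≡⟨ cong (λ x → incidenceSum G wG a + (k * size G + x)) (rowSum a) ⟩
        incidenceSum G wG a + (k * size G + (g + s a))            ≡⟨ rearrange (incidenceSum G wG a) (k * size G) g (s a) ⟩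
        base a + common                                           ∎
        where
        open ≡-Reasoning
        rearrange : ∀ a b g s → a + (b + (g + s)) ≡ a + s + (b + g)
        rearrange = solve-∀

      vsum-column : ∀ c → vsum labeling (m ↑ʳ c) ≡ m * size G + z
      vsum-column c = trans (vsum-↑ʳ c) (trans (∑-const-+ (size G) (λ a → M a c)) (cong (m * size G +_) (columnSum c)))

    antimagic : IsLocalAntimagic labeling
    antimagic u v u~v eq = separate (splitAt m u) (splitAt m v) (join-splitAt m k u) (join-splitAt m k v)
      where
      separate : ∀ x y → join m k x ≡ u → join m k y ≡ v → ⊥
      separate (inj₁ a) (inj₁ b) refl refl = proper a b (subst T (adj-ˡˡ a b) u~v)
        (+-cancelʳ-≡ common (base a) (base b) (trans (sym (vsum-row a)) (trans eq (vsum-row b))))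
      separate (inj₁ a) (inj₂ c) refl refl = row≢column a (trans (sym (vsum-row a)) (trans eq (vsum-column c)))
      separate (inj₂ c) (inj₁ a) refl refl = row≢column a (trans (sym (vsum-row a)) (trans (sym eq) (vsum-column c)))
      separate (inj₂ c) (inj₂ d) refl refl = subst T (adj-ʳʳ c d) u~v

    -- Equal column sums give O_k a single colour, and adding `common` throughout G does not create
    -- new values.
    numColors-≤-suc : numColors labeling ≤ suc (length (deduplicate _≟_ (tabulate base)))
    numColors-≤-suc = subst (numColors labeling ≤_) (cong suc (length-map (_+ common) bases))
      (numColors-≤ labeling (m * size G + z ∷ map (_+ common) bases) λ u → vsum∈colours (splitAt m u) (join-splitAt m k u))
      where
      bases : List ℕ
      bases = deduplicate _≟_ (tabulate base)

      vsum∈colours : ∀ {u} x → join m k x ≡ u → vsum labeling u ∈ m * size G + z ∷ map (_+ common) bases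
      vsum∈colours (inj₁ a) refl = there (subst (_∈ map (_+ common) bases) (sym (vsum-row a))
        (∈-map⁺ (_+ common) (∈-deduplicate⁺ _≟_ (∈-tabulate⁺ a))))
      vsum∈colours (inj₂ c) refl = here (vsum-column c)

-- Growing a balanced matrix by two columns.

-- Here `b` is the number of entries of the old matrix. Each row pairs a small label `x` with
-- `17 + b - x`. The columns balance because 1 + 4 + 5 + 8 = 2 + 3 + 6 + 7 and each contains four
-- large labels.
outer₀ outer₁ : ℕ → Fin 8 → ℕ
outer₀ b = Vec.lookup (1 ∷ 15 + b ∷ 14 + b ∷ 4 ∷ 5 ∷ 11 + b ∷ 10 + b ∷ 8 ∷ [])
outer₁ b = Vec.lookup (16 + b ∷ 2 ∷ 3 ∷ 13 + b ∷ 12 + b ∷ 6 ∷ 7 ∷ 9 + b ∷ [])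

extend : ∀ t {k₀} → (Fin 8 → Fin k₀ → ℕ) → Fin 8 → Fin (t * 2 + k₀) → ℕ
extend zero         M₀ i c             = M₀ i c
extend (suc t) {k₀} M₀ i zero          = outer₀ ((t * 2 + k₀) * 8) i
extend (suc t) {k₀} M₀ i (suc zero)    = outer₁ ((t * 2 + k₀) * 8) i
extend (suc t)      M₀ i (suc (suc c)) = 8 + extend t M₀ i c

-- For closed lists the hypothesis holds by evaluation, so permutations can be certified by
-- computing.
sort≡⇒↭ : ∀ xs {ys} → sort xs ≡ ys → xs ↭ ys
sort≡⇒↭ xs refl = ↭-sym (sort-↭ xs)

-- The new columns supply 1, ..., 8 and b + 9, ..., b + 16; shifting the old entries by 8 fills the
-- gap between them.
extend-perm : ∀ t {k₀} {M₀ : Fin 8 → Fin k₀ → ℕ} →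
              columns M₀ ↭ labels (k₀ * 8) → columns (extend t M₀) ↭ labels ((t * 2 + k₀) * 8)
extend-perm zero         p = p
extend-perm (suc t) {k₀} {M₀} p = begin
  columns (extend (suc t) M₀)
    -- The new columns unfold to `map spread outer` by evaluation, entry by entry.
    ≡⟨ cong (λ xs → map spread outer ++ xs) (columns-map (8 +_) (extend t M₀)) ⟩
  map spread outer ++ map (8 +_) (columns (extend t M₀))
    ↭⟨ ++⁺ (map⁺ spread (sort≡⇒↭ outer {labels 16} refl)) (map⁺ (8 +_) (extend-perm t p)) ⟩
  labels 8 ++ high ++ map (8 +_) (labels b)
    ↭⟨ ++⁺ˡ (labels 8) (++-comm high _) ⟩
  labels 8 ++ map (8 +_) (labels b) ++ map (8 +_) (map (_+ b) (labels 8))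
    ≡⟨ cong (labels 8 ++_) (map-++ (8 +_) (labels b) _) ⟨
  labels 8 ++ map (8 +_) (labels b ++ map (_+ b) (labels 8))
    ≡⟨ cong (λ xs → labels 8 ++ map (8 +_) (labels b ++ xs)) (map-cong (+-comm b) (labels 8)) ⟨
  labels 8 ++ map (8 +_) (labels b ++ map (b +_) (labels 8))
    ≡⟨ cong (λ xs → labels 8 ++ map (8 +_) xs) (labels-+ b 8) ⟨
  labels 8 ++ map (8 +_) (labels (b + 8))
    ≡⟨ labels-+ 8 (b + 8) ⟨
  labels (8 + (b + 8))
    ≡⟨ cong (labels ∘ (8 +_)) (+-comm b 8) ⟩
  labels (16 + b) ∎
  where
  open PermutationReasoning
  b = (t * 2 + k₀) * 8

  -- Sends the outer columns for b = 0 to those for b, reducing the permutation to a closed one.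
  spread : ℕ → ℕ
  spread c = if c <ᵇ 9 then c else c + b

  outer : List ℕ
  outer = tabulate (outer₀ 0) ++ tabulate (outer₁ 0)

  high : List ℕ
  high = map (8 +_) (map (_+ b) (labels 8))

-- The shift adds 8 · 8 to an old column, which is exactly the increase 4 · 16 of the target; the
-- new columns meet the target by the choice of signs.
extend-columnSum : ∀ t {k₀} {M₀ : Fin 8 → Fin k₀ → ℕ} →
  (∀ c → ∑ (λ i → M₀ i c) ≡ 4 + 4 * (k₀ * 8)) →
  ∀ c → ∑ (λ i → extend t M₀ i c) ≡ 4 + 4 * ((t * 2 + k₀) * 8)
extend-columnSum zero    eq c             = eq c
extend-columnSum (suc t) {k₀} eq zero          = lemma ((t * 2 + k₀) * 8)
  where
  lemma : ∀ b → 1 + (15 + b + (14 + b + (4 + (5 + (11 + b + (10 + b + (8 + 0))))))) ≡ 4 + 4 * (16 + b)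
  lemma = solve-∀
extend-columnSum (suc t) {k₀} eq (suc zero)    = lemma ((t * 2 + k₀) * 8)
  where
  lemma : ∀ b → 16 + b + (2 + (3 + (13 + b + (12 + b + (6 + (7 + (9 + b + 0))))))) ≡ 4 + 4 * (16 + b)
  lemma = solve-∀
extend-columnSum (suc t) {k₀} {M₀} eq (suc (suc c)) =
  trans (∑-const-+ 8 (λ i → extend t M₀ i c)) (trans (cong (64 +_) (extend-columnSum t eq c)) (lemma ((t * 2 + k₀) * 8)))
  where
  lemma : ∀ b → 64 + (4 + 4 * b) ≡ 4 + 4 * (16 + b)
  lemma = solve-∀

-- Growth of the row sums against the column sums.

-- With `b = (t * 2 + k₀) * 8`, an extension adds `17 + b` to each row through its new pair, and
-- another `b` through the shift by 8 in each of the `t * 2 + k₀` old columns.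
growth : ℕ → ℕ → ℕ
growth k₀ zero    = 0
growth k₀ (suc t) = 17 + 2 * ((t * 2 + k₀) * 8) + growth k₀ t

extend-rowSum : ∀ t {k₀} (M₀ : Fin 8 → Fin k₀ → ℕ) i → ∑ (extend t M₀ i) ≡ growth k₀ t + ∑ (M₀ i)
extend-rowSum zero         M₀ i = refl
extend-rowSum (suc t) {k₀} M₀ i = begin
  outer₀ b i + (outer₁ b i + ∑ (λ c → 8 + extend t M₀ i c))   ≡⟨ +-assoc (outer₀ b i) _ _ ⟨
  outer₀ b i + outer₁ b i + ∑ (λ c → 8 + extend t M₀ i c)     ≡⟨ cong₂ _+_ (outer-sum i) (trans (∑-const-+ 8 (extend t M₀ i)) (cong (b +_) (extend-rowSum t M₀ i))) ⟩
  17 + b + (b + (growth k₀ t + ∑ (M₀ i)))                     ≡⟨ lemma b (growth k₀ t) (∑ (M₀ i)) ⟩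
  17 + 2 * b + growth k₀ t + ∑ (M₀ i)                         ∎
  where
  open ≡-Reasoning
  b = (t * 2 + k₀) * 8

  outer-sum : ∀ i → outer₀ b i + outer₁ b i ≡ 17 + b
  outer-sum 0F = refl
  outer-sum 1F = cong (15 +_) (+-comm b 2)
  outer-sum 2F = cong (14 +_) (+-comm b 3)
  outer-sum 3F = refl
  outer-sum 4F = refl
  outer-sum 5F = cong (11 +_) (+-comm b 6)
  outer-sum 6F = cong (10 +_) (+-comm b 7)
  outer-sum 7F = refl

  lemma : ∀ b g s → 17 + b + (b + (g + s)) ≡ 17 + 2 * b + g + s
  lemma = solve-∀

-- After four extensions the two sides differ by `32 * k₀`, with equality for `k₀ = 0`. Each further
-- extension adds 64 on the left and at least that much on the right.
growth-≥ : ∀ k₀ t → 4 + 4 * (((4 + t) * 2 + k₀) * 8) ≤ growth k₀ (4 + t)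
growth-≥ k₀ zero    = subst (4 + 4 * ((8 + k₀) * 8) ≤_) (lemma k₀) (m≤m+n (4 + 4 * ((8 + k₀) * 8)) (32 * k₀))
  where
  lemma : ∀ k₀ → 4 + 4 * ((8 + k₀) * 8) + 32 * k₀ ≡
    17 + 2 * ((6 + k₀) * 8) + (17 + 2 * ((4 + k₀) * 8) + (17 + 2 * ((2 + k₀) * 8) + (17 + 2 * (k₀ * 8) + 0)))
  lemma = solve-∀
growth-≥ k₀ (suc t) = begin
  4 + 4 * ((2 + k) * 8)                    ≡⟨ lemma k ⟩
  64 + (4 + 4 * (k * 8))                   ≤⟨ +-mono-≤ step (growth-≥ k₀ t) ⟩
  17 + 2 * (k * 8) + growth k₀ (4 + t)     ∎
  where
  open ≤-Reasoning
  k = (4 + t) * 2 + k₀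

  lemma : ∀ k → 4 + 4 * ((2 + k) * 8) ≡ 64 + (4 + 4 * (k * 8))
  lemma = solve-∀

  step : 64 ≤ 17 + 2 * (k * 8)
  -- The bound `4 ≤ k` already gives `64 ≤ 2 * (k * 8)`.
  step = ≤-trans (*-monoʳ-≤ 2 (*-monoˡ-≤ 8 (≤-trans (m≤m+n 4 _) (m≤m+n ((4 + t) * 2) k₀)))) (m≤n+m _ 17)

-- There are at least 8 columns, so the shift by `q` contributes no less to a row than to a column;
-- `growth-≥` compares the rest. As equality can occur in both, strictness comes from the positive
-- `b`.
columnSum<rowSum : ∀ k₀ q t {b} → 1 ≤ b →
  8 * q + (4 + 4 * (((4 + t) * 2 + k₀) * 8)) < b + (((4 + t) * 2 + k₀) * q + growth k₀ (4 + t))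
columnSum<rowSum k₀ q t 1≤b = +-mono-≤ 1≤b (+-mono-≤ (*-monoˡ-≤ q (m≤m+n 8 (t * 2 + k₀))) (growth-≥ k₀ t))

-- Finite certificates, each covering all k of one parity.

entries : ∀ {r} → Vec (Vec ℕ r) r → Fin r × Fin r → ℕ
entries W (a , b) = Vec.lookup (Vec.lookup W a) b

module Certificate (S : List ℕ) (k₀ : ℕ) (w : Fin 8 × Fin 8 → ℕ) (M₀ : Fin 8 → Fin k₀ → ℕ) where

  G : Graph
  G = circulant 8 S

  base : Fin 8 → ℕ
  base i = incidenceSum G w i + ∑ (M₀ i)

  rowSum : ℕ → Fin 8 → ℕ
  rowSum t i = base i + ((t * 2 + k₀) * size G + growth k₀ t)

  columnSum : ℕ → ℕ
  columnSum t = 8 * size G + (4 + 4 * ((t * 2 + k₀) * 8))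

  -- The last clause covers k < 8, where row and column sums have to be compared one by one.
  Valid : Set
  Valid = sort (map w (edges G)) ≡ labels (size G)
        × sort (columns M₀) ≡ labels (k₀ * 8)
        × (∀ c → ∑ (λ i → M₀ i c) ≡ 4 + 4 * (k₀ * 8))
        × (∀ i j → T (adj G i j) → base i ≢ base j)
        × length (deduplicate _≟_ (tabulate base)) ≤ 4
        × (∀ i → 1 ≤ base i)
        × (∀ (t : Fin 4) i → rowSum (toℕ t) i ≢ columnSum (toℕ t))

  valid? : Dec Valid
  valid? = ≡-dec _≟_ _ _
     ×-dec ≡-dec _≟_ _ _
     ×-dec all? (λ c → _ ≟ _)
     ×-dec all? (λ i → all? λ j → T? (adj G i j) →-dec ¬? (base i ≟ base j))
     ×-dec (_ ≤? 4)
     ×-dec all? (λ i → 1 ≤? base i)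
     ×-dec all? (λ t → all? λ i → ¬? (rowSum (toℕ t) i ≟ columnSum (toℕ t)))

  labeling-5 : Valid → ∀ t → Σ (Labeling (joinO G (t * 2 + k₀))) λ f → IsLocalAntimagic f × numColors f ≤ 5
  labeling-5 (w-perm , M₀-perm , M₀-columnSum , proper , few , positive , small) t =
    J.labeling , J.antimagic , ≤-trans J.numColors-≤-suc (s≤s few)
    where
    row≢column : ∀ t i → rowSum t i ≢ columnSum t
    row≢column 0 i = small 0F i
    row≢column 1 i = small 1F i
    row≢column 2 i = small 2F i
    row≢column 3 i = small 3F i
    -- Four or more extensions mean at least 8 columns, where the growth estimate applies.
    row≢column (suc (suc (suc (suc t)))) i = <⇒≢ (columnSum<rowSum k₀ (size G) t (positive i)) ∘ sym

    -- Taking the row sums of `M₀` for `s` leaves `base` independent of `t`, so one check of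
    -- properness and of the four values serves every extension.
    module J = JoinLabeling G (t * 2 + k₀) w (sort≡⇒↭ (map w (edges G)) w-perm)
      (extend t M₀) (extend-perm t (sort≡⇒↭ (columns M₀) M₀-perm))
      (λ i → ∑ (M₀ i)) (growth k₀ t) (4 + 4 * ((t * 2 + k₀) * 8))
      (extend-rowSum t M₀) (extend-columnSum t M₀-columnSum) proper (row≢column t)

-- From certificates to the value 5.

halve : ∀ k → ∃ λ t → k ≡ t * 2 + 0 ⊎ k ≡ t * 2 + 1
halve 0             = 0 , inj₁ refl
halve 1             = 0 , inj₂ refl
halve (suc (suc k)) with halve k
... | t , inj₁ eq = suc t , inj₁ (cong (2 +_) eq)
... | t , inj₂ eq = suc t , inj₂ (cong (2 +_) eq)

noColumns : Fin 8 → Fin 0 → ℕ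
noColumns _ ()

oneColumn : Vec ℕ 8 → Fin 8 → Fin 1 → ℕ
oneColumn v i _ = Vec.lookup v i

-- On concrete data the three `True` hypotheses evaluate to the unit type, so type checking carries
-- out the finite verification. The vertex of O_k provided by `1 ≤ k` completes the K₅ of the lower
-- bound.
chiLa-5 : ∀ S (us : Vec (Fin 8) 4) (W W′ : Vec (Vec ℕ 8) 8) (v : Vec ℕ 8) →
  True (allPairs? (λ x y → T? (adj (circulant 8 S) x y)) (Vec.toList us)) →
  True (Certificate.valid? S 0 (entries W) noColumns) →
  True (Certificate.valid? S 1 (entries W′) (oneColumn v)) →
  ∀ k → 1 ≤ k → ChiLa (joinO (circulant 8 S) k) 5
chiLa-5 S (_ ∷ _ ∷ _ ∷ _ ∷ []) W W′ v clique even odd (suc k) _ = attained (labeling (halve (suc k))) , bound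
  where
  H : Graph
  H = joinO (circulant 8 S) (suc k)

  bound : ∀ (f : Labeling H) → IsLocalAntimagic f → 5 ≤ numColors f
  bound = clique-bound (clique-joinO (circulant 8 S) (suc k) zero (toWitness clique))

  AtMost5 : ℕ → Set
  AtMost5 k = Σ (Labeling (joinO (circulant 8 S) k)) λ f → IsLocalAntimagic f × numColors f ≤ 5

  labeling : (∃ λ t → suc k ≡ t * 2 + 0 ⊎ suc k ≡ t * 2 + 1) → AtMost5 (suc k)
  labeling (t , inj₁ eq) = subst AtMost5 (sym eq) (Certificate.labeling-5 S 0 (entries W) noColumns (toWitness even) t)
  labeling (t , inj₂ eq) = subst AtMost5 (sym eq) (Certificate.labeling-5 S 1 (entries W′) (oneColumn v) (toWitness odd) t)

  attained : AtMost5 (suc k) → Σ (Labeling H) λ f → IsLocalAntimagic f × numColors f ≡ 5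
  attained (f , antimagic , ≤5) = f , antimagic , ≤-antisym ≤5 (bound f antimagic)

-- Explicit data for the three graphs.

-- Adjacency matrices of G with labels as entries (0 for a non-edge), found by local search.
weights-124-even : Vec (Vec ℕ 8) 8
weights-124-even =
  ( 0 ∷ 13 ∷  6 ∷  0 ∷ 18 ∷  0 ∷ 20 ∷ 10 ∷ []) ∷
  (13 ∷  0 ∷  1 ∷ 17 ∷  0 ∷  3 ∷  0 ∷ 14 ∷ []) ∷
  ( 6 ∷  1 ∷  0 ∷ 16 ∷  9 ∷  0 ∷  8 ∷  0 ∷ []) ∷
  ( 0 ∷ 17 ∷ 16 ∷  0 ∷ 15 ∷ 12 ∷  0 ∷  7 ∷ []) ∷
  (18 ∷  0 ∷  9 ∷ 15 ∷  0 ∷  2 ∷ 11 ∷  0 ∷ []) ∷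
  ( 0 ∷  3 ∷  0 ∷ 12 ∷  2 ∷  0 ∷  4 ∷ 19 ∷ []) ∷
  (20 ∷  0 ∷  8 ∷  0 ∷ 11 ∷  4 ∷  0 ∷  5 ∷ []) ∷
  (10 ∷ 14 ∷  0 ∷  7 ∷  0 ∷ 19 ∷  5 ∷  0 ∷ []) ∷
  []

weights-134-even : Vec (Vec ℕ 8) 8
weights-134-even =
  ( 0 ∷ 10 ∷  0 ∷ 15 ∷ 14 ∷  6 ∷  0 ∷ 13 ∷ []) ∷
  (10 ∷  0 ∷  2 ∷  0 ∷  9 ∷  1 ∷ 20 ∷  0 ∷ []) ∷
  ( 0 ∷  2 ∷  0 ∷  3 ∷  0 ∷ 16 ∷ 19 ∷ 18 ∷ []) ∷
  (15 ∷  0 ∷  3 ∷  0 ∷ 12 ∷  0 ∷  4 ∷  8 ∷ []) ∷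
  (14 ∷  9 ∷  0 ∷ 12 ∷  0 ∷ 17 ∷  0 ∷  7 ∷ []) ∷
  ( 6 ∷  1 ∷ 16 ∷  0 ∷ 17 ∷  0 ∷ 11 ∷  0 ∷ []) ∷
  ( 0 ∷ 20 ∷ 19 ∷  4 ∷  0 ∷ 11 ∷  0 ∷  5 ∷ []) ∷
  (13 ∷  0 ∷ 18 ∷  8 ∷  7 ∷  0 ∷  5 ∷  0 ∷ []) ∷
  []

weights-123-even : Vec (Vec ℕ 8) 8
weights-123-even =
  ( 0 ∷ 10 ∷ 15 ∷  5 ∷  0 ∷  8 ∷ 16 ∷  9 ∷ []) ∷
  (10 ∷  0 ∷ 21 ∷ 17 ∷  3 ∷  0 ∷ 23 ∷ 13 ∷ []) ∷
  (15 ∷ 21 ∷  0 ∷ 22 ∷  6 ∷ 11 ∷  0 ∷  1 ∷ []) ∷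
  ( 5 ∷ 17 ∷ 22 ∷  0 ∷  2 ∷ 24 ∷  4 ∷  0 ∷ []) ∷
  ( 0 ∷  3 ∷  6 ∷  2 ∷  0 ∷ 18 ∷ 14 ∷ 20 ∷ []) ∷
  ( 8 ∷  0 ∷ 11 ∷ 24 ∷ 18 ∷  0 ∷  7 ∷ 19 ∷ []) ∷
  (16 ∷ 23 ∷  0 ∷  4 ∷ 14 ∷  7 ∷  0 ∷ 12 ∷ []) ∷
  ( 9 ∷ 13 ∷  1 ∷  0 ∷ 20 ∷ 19 ∷ 12 ∷  0 ∷ []) ∷
  []

weights-124-odd : Vec (Vec ℕ 8) 8
weights-124-odd =
  ( 0 ∷  9 ∷ 19 ∷  0 ∷ 10 ∷  0 ∷  2 ∷  7 ∷ []) ∷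
  ( 9 ∷  0 ∷ 13 ∷ 17 ∷  0 ∷ 18 ∷  0 ∷ 11 ∷ []) ∷
  (19 ∷ 13 ∷  0 ∷  4 ∷  3 ∷  0 ∷ 12 ∷  0 ∷ []) ∷
  ( 0 ∷ 17 ∷  4 ∷  0 ∷  8 ∷ 14 ∷  0 ∷  1 ∷ []) ∷
  (10 ∷  0 ∷  3 ∷  8 ∷  0 ∷  5 ∷ 16 ∷  0 ∷ []) ∷
  ( 0 ∷ 18 ∷  0 ∷ 14 ∷  5 ∷  0 ∷ 15 ∷  6 ∷ []) ∷
  ( 2 ∷  0 ∷ 12 ∷  0 ∷ 16 ∷ 15 ∷  0 ∷ 20 ∷ []) ∷
  ( 7 ∷ 11 ∷  0 ∷  1 ∷  0 ∷  6 ∷ 20 ∷  0 ∷ []) ∷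
  []

-- The matrix for k = 1. As a permutation of 1, ..., 8 it has the required sum 36; its order is
-- matched to `weights-124-odd` so that the vertices of G take four sums.
column-124 : Vec ℕ 8
column-124 = 3 ∷ 2 ∷ 8 ∷ 6 ∷ 7 ∷ 1 ∷ 5 ∷ 4 ∷ []

weights-134-odd : Vec (Vec ℕ 8) 8
weights-134-odd =
  ( 0 ∷  7 ∷  0 ∷  2 ∷ 20 ∷ 13 ∷  0 ∷ 10 ∷ []) ∷
  ( 7 ∷  0 ∷ 19 ∷  0 ∷  3 ∷  4 ∷ 16 ∷  0 ∷ []) ∷
  ( 0 ∷ 19 ∷  0 ∷ 15 ∷  0 ∷  9 ∷  1 ∷ 11 ∷ []) ∷
  ( 2 ∷  0 ∷ 15 ∷  0 ∷  5 ∷  0 ∷ 14 ∷  6 ∷ []) ∷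
  (20 ∷  3 ∷  0 ∷  5 ∷  0 ∷ 18 ∷  0 ∷ 12 ∷ []) ∷
  (13 ∷  4 ∷  9 ∷  0 ∷ 18 ∷  0 ∷  8 ∷  0 ∷ []) ∷
  ( 0 ∷ 16 ∷  1 ∷ 14 ∷  0 ∷  8 ∷  0 ∷ 17 ∷ []) ∷
  (10 ∷  0 ∷ 11 ∷  6 ∷ 12 ∷  0 ∷ 17 ∷  0 ∷ []) ∷
  []

column-134 : Vec ℕ 8
column-134 = 7 ∷ 1 ∷ 4 ∷ 8 ∷ 3 ∷ 6 ∷ 5 ∷ 2 ∷ []

weights-123-odd : Vec (Vec ℕ 8) 8
weights-123-odd =
  ( 0 ∷ 17 ∷  3 ∷ 11 ∷  0 ∷ 12 ∷  6 ∷  4 ∷ []) ∷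
  (17 ∷  0 ∷ 21 ∷  5 ∷ 10 ∷  0 ∷ 22 ∷ 13 ∷ []) ∷
  ( 3 ∷ 21 ∷  0 ∷  1 ∷ 16 ∷ 18 ∷  0 ∷ 23 ∷ []) ∷
  (11 ∷  5 ∷  1 ∷  0 ∷ 15 ∷ 24 ∷ 14 ∷  0 ∷ []) ∷
  ( 0 ∷ 10 ∷ 16 ∷ 15 ∷  0 ∷  8 ∷  2 ∷  7 ∷ []) ∷
  (12 ∷  0 ∷ 18 ∷ 24 ∷  8 ∷  0 ∷ 19 ∷  9 ∷ []) ∷
  ( 6 ∷ 22 ∷  0 ∷ 14 ∷  2 ∷ 19 ∷  0 ∷ 20 ∷ []) ∷
  ( 4 ∷ 13 ∷ 23 ∷  0 ∷  7 ∷  9 ∷ 20 ∷  0 ∷ []) ∷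
  []

column-123 : Vec ℕ 8
column-123 = 8 ∷ 4 ∷ 6 ∷ 7 ∷ 3 ∷ 2 ∷ 5 ∷ 1 ∷ []

theorem3p14 : ∀ (S : List ℕ)
    → S ∈ ((1 ∷ 2 ∷ 4 ∷ []) ∷ (1 ∷ 3 ∷ 4 ∷ []) ∷ (1 ∷ 2 ∷ 3 ∷ []) ∷ [])
    → ∀ (k : ℕ) → 3 ≤ k → ChiLa (joinO (circulant 8 S) k) 5
theorem3p14 _ (here refl) k 3≤k =
  -- The even residues are at cyclic distances 2 and 4.
  chiLa-5 (1 ∷ 2 ∷ 4 ∷ []) (0F ∷ 2F ∷ 4F ∷ 6F ∷ [])
    weights-124-even weights-124-odd column-124 _ _ _ k (≤-trans (s≤s z≤n) 3≤k)
theorem3p14 _ (there (here refl)) k 3≤k =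
  -- Two adjacent vertices and their antipodes are at distances 1, 3 and 4.
  chiLa-5 (1 ∷ 3 ∷ 4 ∷ []) (0F ∷ 1F ∷ 4F ∷ 5F ∷ [])
    weights-134-even weights-134-odd column-134 _ _ _ k (≤-trans (s≤s z≤n) 3≤k)
theorem3p14 _ (there (there (here refl))) k 3≤k =
  -- Four consecutive vertices are at distances 1, 2 and 3.
  chiLa-5 (1 ∷ 2 ∷ 3 ∷ []) (0F ∷ 1F ∷ 2F ∷ 3F ∷ [])
    weights-123-even weights-123-odd column-123 _ _ _ k (≤-trans (s≤s z≤n) 3≤k)
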